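{- The number of minimal absent words of a rooted tree with $n$ nodes whose edges are labeled by letters from an alphabet $\Sigma$ of size $\sigma$ is $O(n\sigma)$. That is, there is an absolute constant $C>0$ such that for all integers $n,\sigma\ge 1$ and every rooted tree $T$ with $n$ nodes and edges labeled by letters of an alphabet of size $\sigma$, $|\mathrm{MAW}(T)|\le C\,n\,\sigma$.
   Context: Let $T$ be a rooted tree whose edges are labeled by letters of a finite alphabet $\Sigma$. For a node $v$ of $T$, $\mathsf{str}(v)$ denotes the word obtained by reading the edge labels along the path from $v$ to the root. The language of $T$ is $L_T=\{\mathsf{str}(v)\mid v \text{ a node of } T\}$. A factor of a word is a contiguous subword. A word $aub$ with $a,b\in\Sigma$ and $u$ a (possibly empty) word over $\Sigma$ is a minimal absent word of $T$ if $aub$ is not a factor of any word in $L_T$, but $au$ is a factor of some word in $L_T$ and $ub$ is a factor of some (possibly different) word in $L_T$. The set of minimal absent words of $T$ is $\mathrm{MAW}(T)$. -}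

module Defs where

open import Data.List using (List; []; _∷_; _∷ʳ_; length)
open import Data.List.Membership.Propositional using (_∈_)
open import Data.List.Relation.Binary.Infix.Heterogeneous using (Infix)
open import Data.List.Relation.Unary.Unique.Propositional using (Unique)
open import Data.Nat using (ℕ)
open import Data.Product using (_×_; _,_; ∃-syntax)
open import Function.Bundles using (_⇔_)
open import Relation.Binary.PropositionalEquality using (_≡_)
open import Relation.Nullary using (¬_)

-- Finite rooted trees with edges labelled in A. The order of the list of
-- outgoing edges carries no meaning, and sibling edges may share a label.
data Tree (A : Set) : Set where
  node : List (A × Tree A) → Tree A

-- A membership proof records a position in the list, so equal edges with
-- equal subtrees still lead to distinct nodes.
data Node {A : Set} : Tree A → Set where
  root  : ∀ {es} → Node (node es)
  below : ∀ {es a t} → (a , t) ∈ es → Node t → Node (node es)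

Word : Set → Set
Word A = List A

-- Labels are read upwards, from the node to the root, so the label of the edge
-- at the root comes last.
str : {A : Set} {T : Tree A} → Node T → Word A
str root                = []
str (below {a = a} _ v) = str v ∷ʳ a

Language : {A : Set} → Tree A → Word A → Set
Language T w = ∃[ v ] str {T = T} v ≡ w

_IsFactorOf_ : {A : Set} → Word A → Word A → Set
x IsFactorOf w = Infix _≡_ x w

Occurs : {A : Set} → Tree A → Word A → Set
Occurs T x = ∃[ w ] (Language T w × x IsFactorOf w)

MAW : {A : Set} → Tree A → Word A → Set
MAW T w = ∃[ a ] ∃[ u ] ∃[ b ]
  ( w ≡ a ∷ (u ∷ʳ b)
  × ¬ Occurs T (a ∷ (u ∷ʳ b))
  × Occurs T (a ∷ u)
  × Occurs T (u ∷ʳ b) )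

-- Cardinality of a set given as a predicate. Listing the elements, rather than
-- counting the Σ-type of the predicate, avoids counting an element once per proof.
HasCardinality : {X : Set} → (X → Set) → ℕ → Set
HasCardinality P k =
  ∃[ xs ] (Unique xs × (∀ x → x ∈ xs ⇔ P x) × length xs ≡ k)

{-# OPTIONS --safe #-}

-- Words are read towards the root, so a word occurs in T exactly when it is a
-- prefix of str v for some node v. Let aub be a minimal absent word. If au is
-- followed by a letter somewhere, that letter is some c ≠ b, so ub and uc both
-- occur and ub is an edge at a branching node of the trie of the words str v.
-- Inserting a word into a trie creates at most two such edges (the new one and,
-- if the attachment point had a single child, its old edge), so there are at
-- most 2n of them and 2nσ words aub of this kind. Otherwise au is str v for a
-- node v, which leaves nσ further words.
module Submission where

open import Data.Fin using (Fin)
open import Data.List using (List; []; _∷_; [_]; _∷ʳ_; _++_; length; filter; map; deduplicate; tabulate; cartesianProductWith; initLast; _∷ʳ′_)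
open import Data.List.Membership.Propositional using (_∈_; find; lose)
open import Data.List.Membership.Propositional.Properties
  using (∈-++⁺ˡ; ∈-++⁺ʳ; ∈-tabulate⁺; ∈-tabulate⁻; ∈-filter⁺; ∈-filter⁻; ∈-deduplicate⁺; ∈-deduplicate⁻; ∈-cartesianProductWith⁺)
open import Data.List.Properties using (≡-dec; length-++; length-filter; length-tabulate; length-map; ∷-injective; ∷ʳ-injective)
open import Data.List.Relation.Binary.Infix.Heterogeneous using (here; there)
open import Data.List.Relation.Binary.Prefix.Heterogeneous using (Prefix; []; _∷_; _++ᵖ_)
import Data.List.Relation.Binary.Prefix.Heterogeneous.Properties as Prefix
open import Data.List.Relation.Unary.Any as Any using (Any; here; there)
import Data.List.Relation.Unary.Unique.DecPropositional.Properties as UniqueDec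
open import Data.Nat using (ℕ; _+_; _*_; _≤_; _<_; z≤n; s≤s)
open import Data.Nat.Properties using (≤-trans; m≤n⇒m≤1+n; +-monoˡ-≤; *-monoʳ-≤; module ≤-Reasoning)
open import Data.Nat.Tactic.RingSolver using (solve-∀)
open import Data.Product using (_×_; _,_; ∃-syntax; proj₁; proj₂)
open import Data.Sum using (_⊎_; inj₁; inj₂)
open import Data.Fin.Properties using () renaming (_≟_ to _≟ᶠ_)
open import Function.Bundles using (_↔_; mk⇔; module Inverse)
open import Function.Properties.Inverse using (↔⇒↣)
open import Relation.Binary.Definitions using (DecidableEquality)
open import Relation.Binary.PropositionalEquality using (_≡_; _≢_; refl; sym; trans; cong; cong₂; subst)
open import Relation.Nullary using (¬_; Dec; yes; no; contradiction)
open import Relation.Nullary.Decidable using (map′; via-injection; _×-dec_; ¬?)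
open import Relation.Unary using (Decidable)
open import Defs

-- Prefixes, and where a word leaves a trie.

_≼_ : {A : Set} → Word A → Word A → Set
_≼_ = Prefix _≡_

-- The nodes of the trie of `S`. For empty `S` there is not even a root.
OccursIn : {A : Set} → List (Word A) → Word A → Set
OccursIn S x = Any (x ≼_) S

≼-trans : {A : Set} {x y z : Word A} → x ≼ y → y ≼ z → x ≼ z
≼-trans = Prefix.trans trans

≼-refl : {A : Set} {x : Word A} → x ≼ x
≼-refl {x = []}    = []
≼-refl {x = _ ∷ _} = refl ∷ ≼-refl

≼-∷ʳ : {A : Set} {u : Word A} {c : A} → u ≼ (u ∷ʳ c)
≼-∷ʳ {c = c} = ≼-refl ++ᵖ [ c ]

OccursIn-≼ : {A : Set} {S : List (Word A)} {x y : Word A} → x ≼ y → OccursIn S y → OccursIn S x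
OccursIn-≼ x≼y = Any.map (≼-trans x≼y)

≼-extend : {A : Set} {u w : Word A} → u ≼ w → w ≡ u ⊎ ∃[ c ] (u ∷ʳ c) ≼ w
≼-extend {w = []}    []         = inj₁ refl
≼-extend {w = c ∷ _} []         = inj₂ (c , refl ∷ [])
≼-extend             (refl ∷ p) with ≼-extend p
... | inj₁ eq      = inj₁ (cong (_ ∷_) eq)
... | inj₂ (c , q) = inj₂ (c , refl ∷ q)

-- Prefixes of one word form a chain. Since both are nonempty, a strict prefix of `v ∷ʳ d` is
-- already a prefix of `v`.
≼-comparable : {A : Set} (u v : Word A) {c d : A} {w : Word A} → (u ∷ʳ c) ≼ w → (v ∷ʳ d) ≼ w →
  u ∷ʳ c ≡ v ∷ʳ d ⊎ (u ∷ʳ c) ≼ v ⊎ (v ∷ʳ d) ≼ u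
≼-comparable []      []      (refl ∷ _) (refl ∷ _) = inj₁ refl
≼-comparable []      (_ ∷ _) (refl ∷ _) (refl ∷ _) = inj₂ (inj₁ (refl ∷ []))
≼-comparable (_ ∷ _) []      (refl ∷ _) (refl ∷ _) = inj₂ (inj₂ (refl ∷ []))
≼-comparable (_ ∷ u) (_ ∷ v) (refl ∷ p) (refl ∷ q) with ≼-comparable u v p q
... | inj₁ eq       = inj₁ (cong (_ ∷_) eq)
... | inj₂ (inj₁ r) = inj₂ (inj₁ (refl ∷ r))
... | inj₂ (inj₂ r) = inj₂ (inj₂ (refl ∷ r))

≼-next : {A : Set} (u : Word A) {b c : A} {w : Word A} → (u ∷ʳ b) ≼ w → (u ∷ʳ c) ≼ w → b ≡ c
≼-next []      (refl ∷ _) (refl ∷ _) = refl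
≼-next (_ ∷ u) (refl ∷ p) (refl ∷ q) = ≼-next u p q

-- The edge by which the path along `w` leaves `P`. For a trie `P`, inserting `w` attaches its new
-- branch at `u`.
Exit : {A : Set} → (Word A → Set) → Word A → Word A → A → Set
Exit P w u c = (u ∷ʳ c) ≼ w × P u × ¬ P (u ∷ʳ c)

-- `P` is arbitrary so that the recursion can pass to its quotient by the first letter of `w`.
exit? : {A : Set} {P : Word A → Set} → Decidable P → (w : Word A) →
  (∃[ u ] ∃[ c ] Exit P w u c) ⊎ (∀ u c → ¬ Exit P w u c)
exit? P? [] = inj₂ λ { [] _ (() , _) ; (_ ∷ _) _ (() , _) }
exit? P? (x ∷ w) with exit? (λ y → P? (x ∷ y)) w | P? [] ×-dec ¬? (P? [ x ])
... | inj₁ (u , c , p , q) | _            = inj₁ (x ∷ u , c , refl ∷ p , q)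
... | inj₂ _               | yes q        = inj₁ ([] , x , refl ∷ [] , q)
... | inj₂ none            | no ¬q        = inj₂ λ
  { []      _ (refl ∷ _ , q) → ¬q q
  ; (_ ∷ u) c (refl ∷ p , q) → none u c (p , q) }

-- Otherwise the end of one exit edge would be a prefix of the start of the other; tries are closed
-- under prefixes, so it would not lie outside.
exit-unique : {A : Set} {S : List (Word A)} {w u v : Word A} {c d : A} →
  Exit (OccursIn S) w u c → Exit (OccursIn S) w v d → u ∷ʳ c ≡ v ∷ʳ d
exit-unique {u = u} {v} (p , Pu , ¬Puc) (q , Pv , ¬Pvd) with ≼-comparable u v p q
... | inj₁ eq       = eq
... | inj₂ (inj₁ r) = contradiction (OccursIn-≼ r Pv) ¬Puc
... | inj₂ (inj₂ r) = contradiction (OccursIn-≼ r Pu) ¬Pvd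

-- Counting by lists of candidates.

length-cartesianProductWith : {X Y Z : Set} (f : X → Y → Z) (xs : List X) (ys : List Y) →
  length (cartesianProductWith f xs ys) ≡ length xs * length ys
length-cartesianProductWith f []       ys = refl
length-cartesianProductWith f (x ∷ xs) ys = trans (length-++ (map (f x) ys))
  (cong₂ _+_ (length-map (f x) ys) (length-cartesianProductWith f xs ys))

length-deduplicate : {X : Set} (_≟_ : DecidableEquality X) (xs : List X) →
  length (deduplicate _≟_ xs) ≤ length xs
length-deduplicate _≟_ []       = z≤n
length-deduplicate _≟_ (x ∷ xs) =
  s≤s (≤-trans (length-filter _ (deduplicate _≟_ xs)) (length-deduplicate _≟_ xs))

HasCardinality-filter : {X : Set} {P : X → Set} → DecidableEquality X → Decidable P →
  (xs : List X) → (∀ {x} → P x → x ∈ xs) → ∃[ k ] (HasCardinality P k × k ≤ length xs)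
HasCardinality-filter _≟_ P? xs covers =
  length ys , (ys , UniqueDec.deduplicate-! _≟_ _ , (λ x → mk⇔
    (λ x∈ys → proj₂ (∈-filter⁻ P? {xs = xs} (∈-deduplicate⁻ _≟_ (filter P? xs) x∈ys)))
    (λ Px → ∈-deduplicate⁺ _≟_ (∈-filter⁺ P? (covers Px) Px))) , refl)
  , ≤-trans (length-deduplicate _≟_ (filter P? xs)) (length-filter P? xs)
  where ys = deduplicate _≟_ (filter P? xs)

-- Factors as prefixes.

infix-tail : {A : Set} {a : A} {x w : Word A} → (a ∷ x) IsFactorOf w → x IsFactorOf w
infix-tail (here (_ ∷ p)) = there (here p)
infix-tail (there i)      = there (infix-tail i)

-- The first letter of `str v` labels the edge just above `v`, so the parent of `v` spells the rest.
str-tail : {A : Set} {T : Tree A} (v : Node T) {c : A} {w : Word A} →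
  str v ≡ c ∷ w → Language T w
str-tail (below e v) eq with str v in eqv
... | []    = root , proj₂ (∷-injective eq)
... | _ ∷ _ with v′ , eq′ ← str-tail v eqv =
  below e v′ , trans (cong (_∷ʳ _) eq′) (proj₂ (∷-injective eq))

-- Each letter skipped before the occurrence is one step from the node to its parent.
infix⇒prefix : {A : Set} {T : Tree A} {x w : Word A} →
  x IsFactorOf w → Language T w → ∃[ v ] x ≼ str {T = T} v
infix⇒prefix (here p)  (v , refl) = v , p
infix⇒prefix (there i) (v , eq)   = infix⇒prefix i (str-tail v eq)

-- Edges at branching nodes of a trie.

module _ {A : Set} (_≟_ : DecidableEquality A) (letters : List A) (complete : ∀ a → a ∈ letters) where

  occursIn? : (S : List (Word A)) → Decidable (OccursIn S)
  occursIn? S x = Any.any? (Prefix.prefix? _≟_ x) S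

  child? : (S : List (Word A)) (u : Word A) → Dec (∃[ d ] OccursIn S (u ∷ʳ d))
  child? S u = map′ Any.satisfied (λ (d , p) → lose (complete d) p)
    (Any.any? (λ d → occursIn? S (u ∷ʳ d)) letters)

  -- A trie edge is named by its lower end. `B` may contain other edges too.
  CoversBranching : List (Word A) → List (Word A) → Set
  CoversBranching S B = ∀ u {b c} → b ≢ c → OccursIn S (u ∷ʳ b) → OccursIn S (u ∷ʳ c) → (u ∷ʳ b) ∈ B

  -- Two sibling edges cannot both lie on `w`. If one lies on `w` and is new, its sibling in the old
  -- trie puts `u` there as well, so the new edge is the exit.
  covers-∷ : ∀ {S B w} → CoversBranching S B →
    (∀ u {b c} → Exit (OccursIn S) w u b → OccursIn S (u ∷ʳ c) → (u ∷ʳ b) ∈ B × (u ∷ʳ c) ∈ B) →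
    CoversBranching (w ∷ S) B
  covers-∷         covers new u         b≢c (there p) (there q) = covers u b≢c p q
  covers-∷         covers new u         b≢c (here p)  (here q)  = contradiction (≼-next u p q) b≢c
  covers-∷ {S = S} covers new u {b}     b≢c (here p)  (there q) with occursIn? S (u ∷ʳ b)
  ... | yes p′ = covers u b≢c p′ q
  ... | no ¬p  = proj₁ (new u (p , OccursIn-≼ ≼-∷ʳ q , ¬p) q)
  covers-∷ {S = S} covers new u {c = c} b≢c (there p) (here q)  with occursIn? S (u ∷ʳ c)
  ... | yes q′ = covers u b≢c p q′
  ... | no ¬q  = proj₂ (new u (q , OccursIn-≼ ≼-∷ʳ p , ¬q) p)

  -- Induction on `S`, inserting one word at a time. The factor 2 stands on the right so that each
  -- insertion unfolds to two successors.
  branchingEdges : (S : List (Word A)) → ∃[ B ] (length B ≤ length S * 2 × CoversBranching S B)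
  branchingEdges [] = [] , z≤n , λ _ _ ()
  branchingEdges (w ∷ S) with branchingEdges S | exit? (occursIn? S) w
  ... | B , B≤ , covers | inj₂ none =
    B , m≤n⇒m≤1+n (m≤n⇒m≤1+n B≤) , covers-∷ covers (λ u ex _ → contradiction ex (none u _))
  ... | B , B≤ , covers | inj₁ (v , e , ex) with child? S v
  -- `v` is a leaf of the old trie, so the new edge has no sibling and `new` holds vacuously.
  ...   | no ¬child =
    v ∷ʳ e ∷ B , s≤s (m≤n⇒m≤1+n B≤) , covers-∷ (λ u b≢c p q → there (covers u b≢c p q)) new
    where
    new : ∀ u {b c} → Exit (OccursIn S) w u b → OccursIn S (u ∷ʳ c) →
      (u ∷ʳ b) ∈ (v ∷ʳ e ∷ B) × (u ∷ʳ c) ∈ (v ∷ʳ e ∷ B)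
    new u ex′ p with refl , refl ← ∷ʳ-injective u v (exit-unique ex′ ex) = contradiction (_ , p) ¬child
  ...   | yes (d , vd) =
    v ∷ʳ e ∷ v ∷ʳ d ∷ B , s≤s (s≤s B≤) , covers-∷ (λ u b≢c p q → there (there (covers u b≢c p q))) new
    where
    new : ∀ u {b c} → Exit (OccursIn S) w u b → OccursIn S (u ∷ʳ c) →
      (u ∷ʳ b) ∈ (v ∷ʳ e ∷ v ∷ʳ d ∷ B) × (u ∷ʳ c) ∈ (v ∷ʳ e ∷ v ∷ʳ d ∷ B)
    new u {c = c} ex′ p with refl , refl ← ∷ʳ-injective u v (exit-unique ex′ ex) | c ≟ d
    ... | yes refl = here refl , there (here refl)
    -- One old child `d` is enough: with a second child `c`, `v` was branching before, so `B`
    -- contains `v ∷ʳ c`.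
    ... | no c≢d   = here refl , there (there (covers u c≢d p vd))

  -- Deciding and counting minimal absent words.

  module _ {T : Tree A} (S : List (Word A)) (str∈S : ∀ v → str {T = T} v ∈ S) (S⊆ : ∀ {w} → w ∈ S → Language T w) where

    occurs⇒occursIn : ∀ {x} → Occurs T x → OccursIn S x
    occurs⇒occursIn (_ , w∈L , i) with v , p ← infix⇒prefix i w∈L = lose (str∈S v) p

    occursIn⇒occurs : ∀ {x} → OccursIn S x → Occurs T x
    occursIn⇒occurs o with w , w∈S , p ← find o = w , S⊆ w∈S , here p

    occurs? : Decidable (Occurs T)
    occurs? x = map′ occursIn⇒occurs occurs⇒occursIn (occursIn? S x)

    maw? : Decidable (MAW T)
    maw? [] = no λ ()
    maw? (a ∷ v) with initLast v
    -- A minimal absent word has at least two letters.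
    ... | []      = no λ { (_ , [] , _ , () , _) ; (_ , _ ∷ _ , _ , () , _) }
    ... | u ∷ʳ′ b = map′ (λ p → a , u , b , refl , p) invert
      (¬? (occurs? (a ∷ (u ∷ʳ b))) ×-dec occurs? (a ∷ u) ×-dec occurs? (u ∷ʳ b))
      where
      invert : MAW T (a ∷ (u ∷ʳ b)) →
        ¬ Occurs T (a ∷ (u ∷ʳ b)) × Occurs T (a ∷ u) × Occurs T (u ∷ʳ b)
      invert (_ , u′ , _ , eq , p) with refl , eq′ ← ∷-injective eq
        with refl , refl ← ∷ʳ-injective u u′ eq′ = p

    branching : List (Word A)
    branching = proj₁ (branchingEdges S)

    candidates : List (Word A)
    candidates = cartesianProductWith _∷_ letters branching ++ cartesianProductWith _∷ʳ_ S letters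

    maw∈candidates : ∀ {w} → MAW T w → w ∈ candidates
    maw∈candidates (a , u , b , refl , ¬aub , au , ub) with find (occurs⇒occursIn au)
    ... | s , s∈S , au≼s with ≼-extend au≼s
    -- Here `a ∷ u` is all of `s`, the word of a node.
    ... | inj₁ refl = ∈-++⁺ʳ (cartesianProductWith _∷_ letters branching)
      (∈-cartesianProductWith⁺ _∷ʳ_ s∈S (complete b))
    -- Here `c` follows `a ∷ u` in `s`; it differs from `b` because `aub` is absent, so `u`
    -- branches.
    ... | inj₂ (c , auc≼s) = ∈-++⁺ˡ (∈-cartesianProductWith⁺ _∷_ (complete a)
      (proj₂ (proj₂ (branchingEdges S)) u b≢c (occurs⇒occursIn ub) (occurs⇒occursIn uc)))
      where
      auc : Occurs T (a ∷ (u ∷ʳ c))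
      auc = occursIn⇒occurs (lose s∈S auc≼s)
      uc : Occurs T (u ∷ʳ c)
      uc with w , w∈L , i ← auc = w , w∈L , infix-tail i
      b≢c : b ≢ c
      b≢c refl = ¬aub auc

    length-candidates : length candidates ≤ 3 * length S * length letters
    length-candidates = begin
      length candidates
        ≡⟨ length-++ (cartesianProductWith _∷_ letters branching) ⟩
      length (cartesianProductWith _∷_ letters branching) + length (cartesianProductWith _∷ʳ_ S letters)
        ≡⟨ cong₂ _+_ (length-cartesianProductWith _∷_ letters branching) (length-cartesianProductWith _∷ʳ_ S letters) ⟩
      length letters * length branching + length S * length letters
        ≤⟨ +-monoˡ-≤ _ (*-monoʳ-≤ (length letters) (proj₁ (proj₂ (branchingEdges S)))) ⟩
      length letters * (length S * 2) + length S * length letters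
        ≡⟨ arith (length letters) (length S) ⟩
      3 * length S * length letters ∎
      where
      open ≤-Reasoning
      arith : ∀ σ n → σ * (n * 2) + n * σ ≡ 3 * n * σ
      arith = solve-∀

    maw-cardinality : ∃[ k ] (HasCardinality (MAW T) k × k ≤ 3 * length S * length letters)
    maw-cardinality with k , card , k≤ ← HasCardinality-filter (≡-dec _≟_) maw? candidates maw∈candidates =
      k , card , ≤-trans k≤ length-candidates

theorem1 : ∃[ C ] (0 < C ×
    (∀ (n σ : ℕ) → 1 ≤ n → 1 ≤ σ →
    (A : Set) → A ↔ Fin σ →
    (T : Tree A) → Node T ↔ Fin n →
    ∃[ k ] (HasCardinality (MAW T) k × k ≤ C * n * σ)))
-- Two for the branching edges per node, one for the words of nodes extended by a letter.
theorem1 = 3 , s≤s z≤n , bound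
  where
  bound : (n σ : ℕ) → 1 ≤ n → 1 ≤ σ → (A : Set) → A ↔ Fin σ → (T : Tree A) → Node T ↔ Fin n →
    ∃[ k ] (HasCardinality (MAW T) k × k ≤ 3 * n * σ)
  bound n σ _ _ A A↔ T N↔ =
    subst (λ m → ∃[ k ] (HasCardinality (MAW T) k × k ≤ m))
      (cong₂ (λ i j → 3 * i * j) (length-tabulate word) (length-tabulate letter))
      (maw-cardinality (via-injection (↔⇒↣ A↔) _≟ᶠ_) (tabulate letter)
        (λ a → subst (_∈ tabulate letter) (Inverse.strictlyInverseʳ A↔ a) (∈-tabulate⁺ (Inverse.to A↔ a)))
        (tabulate word)
        (λ v → subst (λ v′ → str v′ ∈ tabulate word) (Inverse.strictlyInverseʳ N↔ v) (∈-tabulate⁺ (Inverse.to N↔ v)))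
        (λ w∈ → let i , eq = ∈-tabulate⁻ w∈ in Inverse.from N↔ i , sym eq))
    where
    letter : Fin σ → A
    letter = Inverse.from A↔
    word : Fin n → Word A
    word i = str (Inverse.from N↔ i)
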